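{- Let $\mathbb{F}$ be either the field of real numbers or a finite field in which $-3$ is a quadratic non-residue. For every $n>5$, the $n\times n$ permanent polynomial $Perm_n(x_{11},\ldots,x_{nn})=\sum_{\sigma\in S_n}\prod_{i=1}^n x_{i,\sigma(i)}$ is not expressible as a read-once determinant over $\mathbb{F}$; that is, there is no matrix $M$ (of any size) whose entries lie in $\{x_{ij}:1\le i,j\le n\}\cup\mathbb{F}$, in which each variable $x_{ij}$ occurs in at most one position, such that $\det(M)=Perm_n$.
   Context: $S_n$ denotes the symmetric group on $\{1,\ldots,n\}$. -}

module Defs where

open import Level using (0ℓ)
open import Algebra.Bundles using (CommutativeRing)
open import Data.Nat using (ℕ; zero; suc)
open import Data.Fin using (Fin; zero; suc; punchIn)
open import Data.Product using (Σ; ∃; _×_; _,_)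
open import Data.Sum using (_⊎_)
open import Data.List using (List)
open import Relation.Nullary using (¬_)
open import Relation.Binary.PropositionalEquality using (_≡_)
open import Relation.Binary.Structures using (IsTotalOrder)
import Data.List.Membership.Setoid as SetoidMembership

module _ (F : CommutativeRing 0ℓ 0ℓ) where
  open CommutativeRing F

  IsField : Set
  IsField = (¬ (1# ≈ 0#)) × (∀ x → ¬ (x ≈ 0#) → Σ Carrier λ y → x * y ≈ 1#)

  IsFinite : Set
  IsFinite = Σ (List Carrier) λ xs → ∀ x → SetoidMembership._∈_ setoid x xs

  -- -3 is a quadratic non-residue: it is not a square (in particular ≠ 0).
  Minus3NonResidue : Set
  Minus3NonResidue = ¬ (Σ Carrier λ y → y * y ≈ - (1# + 1# + 1#))

  FiniteFieldMinus3NonResidue : Set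
  FiniteFieldMinus3NonResidue = IsField × IsFinite × Minus3NonResidue

  -- A Dedekind-complete ordered field structure on F.  Up to
  -- isomorphism the unique such field is the field ℝ of real numbers.
  record CompleteOrderedField : Set₁ where
    field
      isField      : IsField
      _≤_          : Carrier → Carrier → Set
      isTotalOrder : IsTotalOrder _≈_ _≤_
      +-mono       : ∀ x y z → x ≤ y → (x + z) ≤ (y + z)
      *-nonneg     : ∀ x y → 0# ≤ x → 0# ≤ y → 0# ≤ (x * y)
      lub          : (P : Carrier → Set) → Σ Carrier P →
                     Σ Carrier (λ b → ∀ x → P x → x ≤ b) →
                     Σ Carrier (λ s → (∀ x → P x → x ≤ s) ×
                                      (∀ b → (∀ x → P x → x ≤ b) → s ≤ b))

  AdmissibleField : Set₁
  AdmissibleField = CompleteOrderedField ⊎ FiniteFieldMinus3NonResidue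

-- The polynomial ring F[x_ij : i,j ∈ Fin n], presented as ring
-- expressions modulo the commutative-ring axioms and the arithmetic of F.

module Polynomials (F : CommutativeRing 0ℓ 0ℓ) (n : ℕ) where
  private
    module F = CommutativeRing F
  C = F.Carrier

  infixl 6 _⊕_
  infixl 7 _⊗_
  infix 4 _≋_

  data Poly : Set where
    con  : C → Poly
    var  : Fin n → Fin n → Poly
    _⊕_  : Poly → Poly → Poly
    _⊗_  : Poly → Poly → Poly
    ⊝_   : Poly → Poly

  𝟘 𝟙 : Poly
  𝟘 = con F.0#
  𝟙 = con F.1#

  data _≋_ : Poly → Poly → Set where
    ≋-refl  : ∀ {p} → p ≋ p
    ≋-sym   : ∀ {p q} → p ≋ q → q ≋ p
    ≋-trans : ∀ {p q r} → p ≋ q → q ≋ r → p ≋ r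
    ⊕-cong  : ∀ {p p' q q'} → p ≋ p' → q ≋ q' → p ⊕ q ≋ p' ⊕ q'
    ⊗-cong  : ∀ {p p' q q'} → p ≋ p' → q ≋ q' → p ⊗ q ≋ p' ⊗ q'
    ⊝-cong  : ∀ {p q} → p ≋ q → ⊝ p ≋ ⊝ q
    ⊕-assoc : ∀ p q r → (p ⊕ q) ⊕ r ≋ p ⊕ (q ⊕ r)
    ⊕-comm  : ∀ p q → p ⊕ q ≋ q ⊕ p
    ⊕-idˡ   : ∀ p → 𝟘 ⊕ p ≋ p
    ⊝-invˡ  : ∀ p → (⊝ p) ⊕ p ≋ 𝟘
    ⊗-assoc : ∀ p q r → (p ⊗ q) ⊗ r ≋ p ⊗ (q ⊗ r)
    ⊗-comm  : ∀ p q → p ⊗ q ≋ q ⊗ p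
    ⊗-idˡ   : ∀ p → 𝟙 ⊗ p ≋ p
    distrib : ∀ p q r → p ⊗ (q ⊕ r) ≋ (p ⊗ q) ⊕ (p ⊗ r)
    con-≈   : ∀ {a b} → a F.≈ b → con a ≋ con b
    con-+   : ∀ a b → con (a F.+ b) ≋ con a ⊕ con b
    con-*   : ∀ a b → con (a F.* b) ≋ con a ⊗ con b
    con-neg : ∀ a → con (F.- a) ≋ ⊝ con a

  sum : ∀ {k} → (Fin k → Poly) → Poly
  sum {zero}  f = 𝟘
  sum {suc k} f = f zero ⊕ sum (λ j → f (suc j))

  altSum : ∀ {k} → (Fin k → Poly) → Poly
  altSum {zero}  f = 𝟘
  altSum {suc k} f = f zero ⊕ (⊝ altSum (λ j → f (suc j)))

  minor : ∀ {k} → (Fin (suc k) → Fin (suc k) → Poly) → Fin (suc k) →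
          Fin k → Fin k → Poly
  minor M j r c = M (suc r) (punchIn j c)

  det : ∀ k → (Fin k → Fin k → Poly) → Poly
  det zero    M = 𝟙
  det (suc k) M = altSum (λ j → M zero j ⊗ det k (minor M j))

  -- permanent (same expansion without signs), i.e. Σ_σ Π_i M i (σ i)
  perm : ∀ k → (Fin k → Fin k → Poly) → Poly
  perm zero    M = 𝟙
  perm (suc k) M = sum (λ j → M zero j ⊗ perm k (minor M j))

  Permₙ : Poly
  Permₙ = perm n var

  data Entry : Set where
    evar  : Fin n → Fin n → Entry
    econst : C → Entry

  toPoly : Entry → Poly
  toPoly (evar i j) = var i j
  toPoly (econst c) = con c

  ReadOnce : ∀ {k} → (Fin k → Fin k → Entry) → Set
  ReadOnce {k} M = ∀ (r c r' c' : Fin k) (a b : Fin n) →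
    M r c ≡ evar a b → M r' c' ≡ evar a b → (r ≡ r') × (c ≡ c')

  IsReadOnceDeterminant : Set
  IsReadOnceDeterminant =
    Σ ℕ λ k → Σ (Fin k → Fin k → Entry) λ M →
      ReadOnce M × (det k (λ r c → toPoly (M r c)) ≋ Permₙ)

{-# OPTIONS --safe #-}

-- Setting variables of Permₙ to constants turns it into 4 e₂(x₀, x₁, x₂, 1), so a read-once
-- determinant for Permₙ gives a matrix N whose determinant is 4 e₂(x₀, x₁, x₂, 1), where each xₜ
-- occurs in one entry. The three entries lie in distinct rows, since otherwise two of the variables
-- could not be multiplied together. For f = det N the three-term Plücker relation on the rows of x₀
-- and x₁ makes f₀ f₁ - f f₀₁ (subscripts denoting derivatives) a product of two polynomials of
-- degree at most 1 in x₂. But this difference is 16 (1 + x₂ + x₂²), of discriminant -3 · 16², so -3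
-- is a square. All identities are used only at points with coordinates 0 or 1.
module Submission where

open import Defs
open import Level using (0ℓ)
open import Algebra.Bundles using (CommutativeRing)
import Algebra.Properties.Monoid.Sum as MonoidSum
import Algebra.Properties.Ring as RingProperties
import Algebra.Properties.Semiring.Mult.TCOptimised as SemiringMult
import Algebra.Solver.Ring.NaturalCoefficients.Default as NatSolver
open import Data.Bool using (Bool; true; false; if_then_else_; _∧_; _∨_)
import Data.Bool.Properties as Bool
open import Data.Empty using (⊥-elim)
open import Data.Fin using (Fin; zero; suc; punchIn; punchOut; inject₁; _≤_; _≟_; _↑ˡ_; _↑ʳ_)
open import Data.Fin.Patterns using (0F; 1F; 2F)
open import Data.Fin.Properties using (punchInᵢ≢i; punchIn-injective; punchIn-punchOut; any?; all?)
open import Data.Nat as ℕ using (ℕ; zero; suc; z≤n; s≤s; _>_)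
import Data.Nat.Properties as ℕ
open import Data.Product using (Σ; _×_; _,_; proj₁; proj₂)
open import Data.Sum using (_⊎_; inj₁; inj₂; [_,_]′; map₂)
import Data.Sum.Properties as Sum
open import Data.Vec as Vec using (Vec; lookup)
open import Data.Vec.Functional using (Vector; []; _∷_)
open import Function using (_∘_; id)
open import Relation.Binary.PropositionalEquality as ≡ using (_≡_; _≢_)
open import Relation.Binary.Structures using (IsTotalOrder)
open import Relation.Nullary using (¬_; Dec; yes; no; does; ¬?; contradiction)
open import Relation.Nullary.Decidable using (from-yes; _→-dec_; _×-dec_; dec-false)
open MonoidSum ℕ.+-0-monoid using (sum; sum-replicate-zero)

-- Deleting two columns in either order.

punchIn-suc-≤ : ∀ {n} {i j : Fin n} → i ≤ j → punchIn (suc j) i ≡ inject₁ i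
punchIn-suc-≤ {i = zero}                  _         = ≡.refl
punchIn-suc-≤ {i = suc _} {j = suc _} (s≤s i≤j) = ≡.cong suc (punchIn-suc-≤ i≤j)

punchIn-inject₁-≤ : ∀ {n} {i j : Fin n} → i ≤ j → punchIn (inject₁ i) j ≡ suc j
punchIn-inject₁-≤ {i = zero}                  _         = ≡.refl
punchIn-inject₁-≤ {i = suc _} {j = suc _} (s≤s i≤j) = ≡.cong suc (punchIn-inject₁-≤ i≤j)

-- The simplicial identity for coface maps. With the two lemmas before it, it matches the deletions
-- (`suc j`, `i`) and (`inject₁ i`, `j`).
punchIn-punchIn : ∀ {n} {i j : Fin (suc n)} → i ≤ j → ∀ k →
  punchIn (suc j) (punchIn i k) ≡ punchIn (inject₁ i) (punchIn j k)
punchIn-punchIn {i = zero}              _         _       = ≡.refl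
punchIn-punchIn {i = suc _} {j = suc _} _         zero    = ≡.refl
punchIn-punchIn {i = suc _} {j = suc _} (s≤s i≤j) (suc k) = ≡.cong suc (punchIn-punchIn i≤j k)

-- Determinants over a commutative ring.

module Determinant (R : CommutativeRing 0ℓ 0ℓ) where
  open CommutativeRing R hiding (zero)
  open RingProperties ring
  open import Relation.Binary.Reasoning.Setoid setoid
  open NatSolver commutativeSemiring using (solve; _:=_; _:+_; _:*_)

  Matrix : ℕ → ℕ → Set
  Matrix m n = Vector (Vector Carrier n) m

  -- Opaque so that unification can recover the summand from a goal; outside the block `altSum-suc`
  -- and `altSum-zero` stand in for the defining equations.
  opaque
    altSum : ∀ {k} → Vector Carrier k → Carrier
    altSum {zero}  f = 0#
    altSum {suc k} f = f zero - altSum (f ∘ suc)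

    altSum-suc : ∀ {k} (f : Vector Carrier (suc k)) → altSum f ≈ f zero - altSum (f ∘ suc)
    altSum-suc f = refl

    altSum-cong : ∀ {k} {f g : Vector Carrier k} → (∀ i → f i ≈ g i) → altSum f ≈ altSum g
    altSum-cong {zero}  f≈g = refl
    altSum-cong {suc k} f≈g = +-cong (f≈g zero) (-‿cong (altSum-cong (f≈g ∘ suc)))

    altSum-zero : ∀ {k} {f : Vector Carrier k} → (∀ i → f i ≈ 0#) → altSum f ≈ 0#
    altSum-zero {zero}      f≈0 = refl
    altSum-zero {suc k} {f} f≈0 = begin
      f zero - altSum (f ∘ suc) ≈⟨ +-cong (f≈0 zero) (-‿cong (altSum-zero (f≈0 ∘ suc))) ⟩
      0# - 0#                   ≈⟨ -‿inverseʳ 0# ⟩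
      0#                        ∎

    altSum-+ : ∀ {k} (f g : Vector Carrier k) → altSum (λ i → f i + g i) ≈ altSum f + altSum g
    altSum-+ {zero}  f g = sym (+-identityˡ 0#)
    altSum-+ {suc k} f g = begin
      (f zero + g zero) - altSum (λ i → f (suc i) + g (suc i))
        ≈⟨ +-congˡ (-‿cong (altSum-+ (f ∘ suc) (g ∘ suc))) ⟩
      (f zero + g zero) - (altSum (f ∘ suc) + altSum (g ∘ suc))
        ≈⟨ +-congˡ (-‿+-comm _ _) ⟨
      (f zero + g zero) + (- altSum (f ∘ suc) - altSum (g ∘ suc))
        ≈⟨ solve 4 (λ a b c d → (a :+ b) :+ (c :+ d) := (a :+ c) :+ (b :+ d)) refl _ _ _ _ ⟩
      altSum f + altSum g ∎

    altSum-*ˡ : ∀ {k} c (f : Vector Carrier k) → altSum (λ i → c * f i) ≈ c * altSum f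
    altSum-*ˡ {zero}  c f = sym (zeroʳ c)
    altSum-*ˡ {suc k} c f = begin
      c * f zero - altSum (λ i → c * f (suc i)) ≈⟨ +-congˡ (-‿cong (altSum-*ˡ c (f ∘ suc))) ⟩
      c * f zero - c * altSum (f ∘ suc)         ≈⟨ x[y-z]≈xy-xz c _ _ ⟨
      c * altSum f                              ∎

    altSum-neg : ∀ {k} (f : Vector Carrier k) → altSum (λ i → - f i) ≈ - altSum f
    altSum-neg f = begin
      altSum (λ i → - f i)      ≈⟨ altSum-cong (λ i → sym (-1*x≈-x (f i))) ⟩
      altSum (λ i → - 1# * f i) ≈⟨ altSum-*ˡ (- 1#) f ⟩
      - 1# * altSum f           ≈⟨ -1*x≈-x _ ⟩
      - altSum f                ∎

    altSum-- : ∀ {k} (f g : Vector Carrier k) → altSum (λ i → f i - g i) ≈ altSum f - altSum g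
    altSum-- f g = trans (altSum-+ f (-_ ∘ g)) (+-congˡ (altSum-neg g))

    altSum-interchange : ∀ {m n} (f : Matrix m n) →
      altSum (λ i → altSum (f i)) ≈ altSum (λ j → altSum (λ i → f i j))
    altSum-interchange {zero}  {n} f = sym (altSum-zero {n} (λ _ → refl))
    altSum-interchange {suc m} {n} f = begin
      altSum (f zero) - altSum (λ i → altSum (f (suc i)))
        ≈⟨ +-congˡ (-‿cong (altSum-interchange (f ∘ suc))) ⟩
      altSum (f zero) - altSum (λ j → altSum (λ i → f (suc i) j))
        ≈⟨ altSum-- (f zero) _ ⟨
      altSum (λ j → altSum (λ i → f i j)) ∎

  -- The terms (suc j , i) and (inject₁ i , j) delete the same two columns, with opposite signs.
  altSum-cancel : ∀ {k} (f : Matrix (suc k) k) →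
    (∀ {i j} → i ≤ j → f (suc j) i ≈ f (inject₁ i) j) →
    altSum (λ j → altSum (f j)) ≈ 0#
  altSum-cancel {zero}  f f-sym = altSum-zero λ j → altSum-zero {f = f j} λ ()
  altSum-cancel {suc k} f f-sym = begin
    altSum (λ j → altSum (f j))
      ≈⟨ trans (altSum-suc _) (+-congˡ (-‿cong (altSum-cong λ j → altSum-suc (f (suc j))))) ⟩
    altSum (f zero) - altSum (λ j → f (suc j) zero - altSum (f (suc j) ∘ suc))
      ≈⟨ +-congˡ (-‿cong (altSum-- _ _)) ⟩
    altSum (f zero) - (altSum (λ j → f (suc j) zero) - altSum (λ j → altSum (f (suc j) ∘ suc)))
      ≈⟨ +-congˡ (-‿cong (+-cong (altSum-cong (λ j → f-sym {zero} {j} z≤n))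
           (-‿cong (altSum-cancel (λ j → f (suc j) ∘ suc) (f-sym ∘ s≤s))))) ⟩
    altSum (f zero) - (altSum (f zero) - 0#)
      ≈⟨ +-congˡ (-‿cong (trans (+-congˡ -0#≈0#) (+-identityʳ _))) ⟩
    altSum (f zero) - altSum (f zero)
      ≈⟨ -‿inverseʳ _ ⟩
    0# ∎

  minor : ∀ {m n} → Matrix (suc m) (suc n) → Fin (suc n) → Matrix m n
  minor M j r c = M (suc r) (punchIn j c)

  det : ∀ k → Matrix k k → Carrier
  det zero    M = 1#
  det (suc k) M = altSum (λ j → M zero j * det k (minor M j))

  det-cong : ∀ k {M N : Matrix k k} → (∀ i j → M i j ≈ N i j) → det k M ≈ det k N
  det-cong zero    M≈N = refl
  det-cong (suc k) M≈N = altSum-cong λ j →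
    *-cong (M≈N zero j) (det-cong k λ r c → M≈N (suc r) (punchIn j c))

  det-row₀-+ : ∀ {k} (a b : Vector Carrier (suc k)) (B : Matrix k (suc k)) →
    det (suc k) ((λ j → a j + b j) ∷ B) ≈ det (suc k) (a ∷ B) + det (suc k) (b ∷ B)
  det-row₀-+ a b B = trans (altSum-cong (λ j → distribʳ _ (a j) (b j))) (altSum-+ _ _)

  private
    pairTerm : ∀ {k} (a b : Vector Carrier (suc (suc k))) (B : Matrix k (suc (suc k))) →
      Matrix (suc (suc k)) (suc k)
    pairTerm {k} a b B j l =
      (a j * b (punchIn j l)) * det k (λ r c → B r (punchIn j (punchIn l c)))

    det-pair : ∀ {k} a b (B : Matrix k (suc (suc k))) →
      det (suc (suc k)) (a ∷ b ∷ B) ≈ altSum (λ j → altSum (pairTerm a b B j))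
    det-pair a b B = altSum-cong λ j →
      trans (sym (altSum-*ˡ (a j) _)) (altSum-cong λ l → sym (*-assoc _ _ _))

    -- Both terms delete the same pair of columns, but in opposite orders, so the entries taken from
    -- the two rows trade places.
    pairTerm-flip : ∀ {k} a b (B : Matrix k (suc (suc k))) {i j} → i ≤ j →
      pairTerm a b B (suc j) i ≈ pairTerm b a B (inject₁ i) j
    pairTerm-flip {k} a b B {i} {j} i≤j = *-cong
      (begin
        a (suc j) * b (punchIn (suc j) i)
          ≡⟨ ≡.cong₂ (λ x y → a x * b y) (≡.sym (punchIn-inject₁-≤ i≤j)) (punchIn-suc-≤ i≤j) ⟩
        a (punchIn (inject₁ i) j) * b (inject₁ i) ≈⟨ *-comm _ _ ⟩
        b (inject₁ i) * a (punchIn (inject₁ i) j) ∎)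
      (det-cong k λ r c → reflexive (≡.cong (B r) (punchIn-punchIn i≤j c)))

  -- With equal rows the pair terms are symmetric under the flip and cancel. Deriving this from
  -- `det-swap₀₁` would only show that twice the determinant vanishes.
  det-equal-rows₀₁ : ∀ {k} a (B : Matrix k (suc (suc k))) → det (suc (suc k)) (a ∷ a ∷ B) ≈ 0#
  det-equal-rows₀₁ a B =
    trans (det-pair a a B) (altSum-cancel (pairTerm a a B) (pairTerm-flip a a B))

  -- The flip exchanges the pair terms of the two orders, so their sum is symmetric and
  -- `altSum-cancel` applies to it.
  det-swap₀₁ : ∀ {k} a b (B : Matrix k (suc (suc k))) →
    det (suc (suc k)) (a ∷ b ∷ B) ≈ - det (suc (suc k)) (b ∷ a ∷ B)
  det-swap₀₁ a b B = +-inverseˡ-unique _ _ (begin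
    det _ (a ∷ b ∷ B) + det _ (b ∷ a ∷ B)
      ≈⟨ +-cong (det-pair a b B) (det-pair b a B) ⟩
    altSum (λ j → altSum (pairTerm a b B j)) + altSum (λ j → altSum (pairTerm b a B j))
      ≈⟨ altSum-+ _ _ ⟨
    altSum (λ j → altSum (pairTerm a b B j) + altSum (pairTerm b a B j))
      ≈⟨ altSum-cong (λ j → sym (altSum-+ (pairTerm a b B j) (pairTerm b a B j))) ⟩
    altSum (λ j → altSum (λ l → pairTerm a b B j l + pairTerm b a B j l))
      ≈⟨ altSum-cancel _ (λ i≤j → trans
           (+-cong (pairTerm-flip a b B i≤j) (pairTerm-flip b a B i≤j)) (+-comm _ _)) ⟩
    0# ∎)

  ∷-cong : ∀ {m n} {a b : Vector Carrier n} {A B : Matrix m n} →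
    (∀ j → a j ≈ b j) → (∀ i j → A i j ≈ B i j) → ∀ i j → (a ∷ A) i j ≈ (b ∷ B) i j
  ∷-cong a≈b A≈B zero    = a≈b
  ∷-cong a≈b A≈B (suc i) = A≈B i

  -- Swapping the top two rows pushes `a` into the minors, where its copy has moved up by one.
  det-equal-rows : ∀ {k} (a : Vector Carrier (suc k)) (B : Matrix k (suc k)) i →
    (∀ j → B i j ≈ a j) → det (suc k) (a ∷ B) ≈ 0#
  det-equal-rows {suc k} a B zero    Bi≈a = begin
    det _ (a ∷ B)           ≈⟨ det-cong _ (∷-cong (λ _ → refl) B≈a∷B′) ⟩
    det _ (a ∷ a ∷ B ∘ suc) ≈⟨ det-equal-rows₀₁ a (B ∘ suc) ⟩
    0#                      ∎
    where
    B≈a∷B′ : ∀ r c → B r c ≈ (a ∷ B ∘ suc) r c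
    B≈a∷B′ zero    = Bi≈a
    B≈a∷B′ (suc r) = λ _ → refl
  det-equal-rows {suc k} a B (suc i) Bi≈a = begin
    det _ (a ∷ B)                  ≈⟨ det-swap₀₁ a (B zero) (B ∘ suc) ⟩
    - det _ (B zero ∷ a ∷ B ∘ suc) ≈⟨ -‿cong (altSum-zero λ j → trans
                                        (*-congˡ (minor≈0 j)) (zeroʳ _)) ⟩
    - 0#                           ≈⟨ -0#≈0# ⟩
    0#                             ∎
    where
    minor≈0 : ∀ j → det (suc k) (minor (B zero ∷ a ∷ B ∘ suc) j) ≈ 0#
    minor≈0 j =
      det-equal-rows (a ∘ punchIn j) (λ r c → B (suc r) (punchIn j c)) i (Bi≈a ∘ punchIn j)

  -- Expand along the first row, then each minor except the corner one along its first column. The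
  -- resulting double sum is carried to that of the transpose by interchanging the summations.
  det-transpose : ∀ k (M : Matrix k k) → det k M ≈ det k (λ i j → M j i)
  det-transpose zero          M = refl
  det-transpose (suc zero)    M = det-cong 1 {M} {λ i j → M j i} λ { zero zero → refl }
  det-transpose (suc (suc k)) M = begin
    det _ M
      ≈⟨ expand (det-transpose (suc k)) M ⟩
    M zero zero * det _ (minor M zero) - altSum (λ j → altSum (cross M j))
      ≈⟨ +-cong (*-congˡ (det-transpose (suc k) (minor M zero)))
           (-‿cong (altSum-interchange (cross M))) ⟩
    M zero zero * det _ (minor Mᵀ zero) - altSum (λ i → altSum (λ j → cross M j i))
      ≈⟨ +-congˡ (-‿cong (altSum-cong λ i → altSum-cong λ j → cross-flip i j)) ⟩
    M zero zero * det _ (minor Mᵀ zero) - altSum (λ i → altSum (cross Mᵀ i))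
      ≈⟨ expand (det-transpose (suc k)) Mᵀ ⟨
    det _ Mᵀ ∎
    where
    Mᵀ : Matrix (suc (suc k)) (suc (suc k))
    Mᵀ i j = M j i
    cross : Matrix (suc (suc k)) (suc (suc k)) → Matrix (suc k) (suc k)
    cross N j i = N zero (suc j) * (N (suc i) zero *
      det k (λ r c → N (suc (punchIn i c)) (suc (punchIn j r))))
    expand : (∀ N → det (suc k) N ≈ det (suc k) (λ i j → N j i)) → ∀ N → det _ N ≈
      N zero zero * det _ (minor N zero) - altSum (λ j → altSum (cross N j))
    expand det-ᵀ N = trans (altSum-suc _) (+-congˡ (-‿cong (altSum-cong λ j → trans
      (*-congˡ (det-ᵀ (minor N (suc j)))) (sym (altSum-*ˡ (N zero (suc j)) _)))))
    cross-flip : ∀ i j → cross M j i ≈ cross Mᵀ i j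
    cross-flip i j = begin
      M zero (suc j) * (M (suc i) zero * det k P)
        ≈⟨ solve 3 (λ a b c → a :* (b :* c) := b :* (a :* c)) refl _ _ _ ⟩
      M (suc i) zero * (M zero (suc j) * det k P)
        ≈⟨ *-congˡ (*-congˡ (det-transpose k P)) ⟩
      M (suc i) zero * (M zero (suc j) * det k (λ r c → P c r)) ∎
      where
      P : Matrix k k
      P r c = M (suc (punchIn i c)) (suc (punchIn j r))

  -- The matrix X below has its first row repeated; expand it along that row.
  cramer : ∀ {k} (t : Vector Carrier (suc k)) (B : Matrix (suc k) (suc k)) j →
    t j * det (suc k) B ≈ altSum (λ i → B i j * det (suc k) (t ∷ B ∘ punchIn i))
  cramer {k} t B j = begin
    t j * det _ B
      ≈⟨ *-congˡ (det-transpose _ B) ⟩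
    t j * det _ (minor X zero)
      ≈⟨ +-inverseˡ-unique _ _ (trans (sym (altSum-suc _))
           (det-equal-rows (λ c → (t ∷ B) c j) (λ r c → (t ∷ B) c r) j (λ _ → refl))) ⟩
    - - altSum (λ i → B i j * det _ (minor X (suc i)))
      ≈⟨ -‿involutive _ ⟩
    altSum (λ i → B i j * det _ (minor X (suc i)))
      ≈⟨ altSum-cong (λ i → *-congˡ (det-transpose (suc k) (minor X (suc i)))) ⟩
    altSum (λ i → B i j * det _ (t ∷ B ∘ punchIn i)) ∎
    where
    X : Matrix (suc (suc k)) (suc (suc k))
    X = (λ c → (t ∷ B) c j) ∷ (λ r c → (t ∷ B) c r)

  -- Apply det (· ∷ b ∷ R) to Cramer's expansion of a along the rows u, v, R: only the
  -- coefficients of u and v survive.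
  plücker : ∀ {k} (a b u v : Vector Carrier (suc (suc k))) (R : Matrix k (suc (suc k))) →
    det _ (a ∷ b ∷ R) * det _ (u ∷ v ∷ R) + det _ (a ∷ u ∷ R) * det _ (v ∷ b ∷ R)
      ≈ det _ (a ∷ v ∷ R) * det _ (u ∷ b ∷ R)
  plücker {k} a b u v R = begin
    L a * det _ B + det _ (a ∷ u ∷ R) * L v
      ≈⟨ +-congʳ expansion ⟩
    altSum (λ i → T i * L (B i)) + det _ (a ∷ u ∷ R) * L v
      ≈⟨ +-congʳ (trans (altSum-suc _) (+-congˡ (-‿cong (trans (altSum-suc _)
           (+-congˡ (trans (-‿cong rest≈0) -0#≈0#)))))) ⟩
    T zero * L u - (T (suc zero) * L v + 0#) + det _ (a ∷ u ∷ R) * L v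
      ≈⟨ +-cong (+-congˡ (-‿cong (+-identityʳ _))) refl ⟩
    T zero * L u - det _ (a ∷ u ∷ R) * L v + det _ (a ∷ u ∷ R) * L v
      ≈⟨ +-assoc _ _ _ ⟩
    T zero * L u + (- (det _ (a ∷ u ∷ R) * L v) + det _ (a ∷ u ∷ R) * L v)
      ≈⟨ trans (+-congˡ (-‿inverseˡ _)) (+-identityʳ _) ⟩
    T zero * L u ∎
    where
    B : Matrix (suc (suc k)) (suc (suc k))
    B = u ∷ v ∷ R
    L : Vector Carrier (suc (suc k)) → Carrier
    L t = det _ (t ∷ b ∷ R)
    T : Vector Carrier (suc (suc k))
    T i = det _ (a ∷ B ∘ punchIn i)
    -- Cofactors of the top row of `L`, without signs: `L t` is by definition the alternating sum of
    -- `t j * κ j`.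
    κ : Vector Carrier (suc (suc k))
    κ j = det (suc k) (λ r c → (b ∷ R) r (punchIn j c))
    rest≈0 : altSum (λ i → T (suc (suc i)) * L (R i)) ≈ 0#
    rest≈0 = altSum-zero λ i → trans
      (*-congˡ (det-equal-rows (R i) (b ∷ R) (suc i) (λ _ → refl))) (zeroʳ _)
    expansion : L a * det _ B ≈ altSum (λ i → T i * L (B i))
    expansion = begin
      L a * det _ B
        ≈⟨ trans (*-comm _ _) (sym (altSum-*ˡ (det _ B) (λ j → a j * κ j))) ⟩
      altSum (λ j → det _ B * (a j * κ j))
        ≈⟨ altSum-cong (λ j → solve 3 (λ d x y → d :* (x :* y) := y :* (x :* d)) refl _ _ _) ⟩
      altSum (λ j → κ j * (a j * det _ B))
        ≈⟨ altSum-cong (λ j → trans (*-congˡ (cramer a B j))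
             (sym (altSum-*ˡ (κ j) (λ i → B i j * T i)))) ⟩
      altSum (λ j → altSum (λ i → κ j * (B i j * T i)))
        ≈⟨ altSum-interchange (λ j i → κ j * (B i j * T i)) ⟩
      altSum (λ i → altSum (λ j → κ j * (B i j * T i)))
        ≈⟨ altSum-cong (λ i → trans
             (altSum-cong λ j → solve 3 (λ d x y → d :* (x :* y) := y :* (x :* d)) refl _ _ _)
             (altSum-*ˡ (T i) (λ j → B i j * κ j))) ⟩
      altSum (λ i → T i * L (B i)) ∎

  sgn : ∀ {k} → Fin k → Carrier
  sgn zero    = 1#
  sgn (suc i) = - sgn i

  -- The hypothesis ranges over the minors below `a`, so that an identity proved in one size lifts
  -- under an additional top row.
  det-∷-scale : ∀ {k} (a : Vector Carrier (suc k)) {A B : Matrix k (suc k)} s →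
    (∀ j → det k (λ r c → A r (punchIn j c)) ≈ s * det k (λ r c → B r (punchIn j c))) →
    det (suc k) (a ∷ A) ≈ s * det (suc k) (a ∷ B)
  det-∷-scale a s A≈sB = trans
    (altSum-cong λ j → trans (*-congˡ (A≈sB j))
      (solve 3 (λ x y z → x :* (y :* z) := y :* (x :* z)) refl _ _ _))
    (altSum-*ˡ s _)

  -- By induction the row rises to second place inside the minors; one swap with the top row then
  -- contributes the last sign.
  det-moveToFront : ∀ {k} (B : Matrix (suc k) (suc k)) i →
    det (suc k) B ≈ sgn i * det (suc k) (B i ∷ B ∘ punchIn i)
  det-moveToFront B zero = sym (*-identityˡ _)
  det-moveToFront {suc k} B (suc i) = begin
    det _ B
      ≈⟨ det-∷-scale (B zero) {A = B ∘ suc} {B = B′} (sgn i) (λ j →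
           det-moveToFront (λ r c → B (suc r) (punchIn j c)) i) ⟩
    sgn i * det _ (B zero ∷ B′)
      ≈⟨ *-congˡ (det-swap₀₁ (B zero) (B (suc i)) (B ∘ suc ∘ punchIn i)) ⟩
    sgn i * - det _ (B (suc i) ∷ B zero ∷ B ∘ suc ∘ punchIn i)
      ≈⟨ trans (sym (-‿distribʳ-* _ _)) (-‿distribˡ-* _ _) ⟩
    - sgn i * det _ (B (suc i) ∷ B ∘ punchIn (suc i)) ∎
    where
    B′ : Matrix (suc k) (suc (suc k))
    B′ = B (suc i) ∷ B ∘ suc ∘ punchIn i

  -- `q` and `r` are positions among the rows that remain after the earlier removals, so the signs
  -- of three successive moves simply multiply.
  det-move₃ToFront : ∀ {k} (B : Matrix (suc (suc (suc k))) (suc (suc (suc k)))) p q r →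
    det _ B ≈ (sgn p * (sgn q * sgn r)) *
      det _ (B p ∷ B (punchIn p q) ∷ B (punchIn p (punchIn q r)) ∷
             B ∘ punchIn p ∘ punchIn q ∘ punchIn r)
  det-move₃ToFront {k} B p q r = begin
    det _ B
      ≈⟨ det-moveToFront B p ⟩
    sgn p * det _ (B p ∷ B₁)
      ≈⟨ *-congˡ (det-∷-scale (B p) {A = B₁} {B = B₁ q ∷ B₂} (sgn q) (λ j →
           det-moveToFront (λ r c → B₁ r (punchIn j c)) q)) ⟩
    sgn p * (sgn q * det _ (B p ∷ B₁ q ∷ B₂))
      ≈⟨ *-congˡ (*-congˡ (det-∷-scale (B p) {A = B₁ q ∷ B₂} {B = B₁ q ∷ B₃} (sgn r) (λ j →
           det-∷-scale (B₁ q ∘ punchIn j) {A = λ r c → B₂ r (punchIn j c)}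
             {B = λ r c → B₃ r (punchIn j c)} (sgn r) (λ j′ →
             det-moveToFront (λ r c → B₂ r (punchIn j (punchIn j′ c))) r)))) ⟩
    sgn p * (sgn q * (sgn r * det _ (B p ∷ B₁ q ∷ B₃)))
      ≈⟨ solve 4 (λ x y z d → x :* (y :* (z :* d)) := (x :* (y :* z)) :* d) refl _ _ _ _ ⟩
    (sgn p * (sgn q * sgn r)) * det _ (B p ∷ B₁ q ∷ B₃) ∎
    where
    B₁ = B ∘ punchIn p
    B₂ = B₁ ∘ punchIn q
    B₃ : Matrix (suc k) (suc (suc (suc k)))
    B₃ = B₂ r ∷ B₂ ∘ punchIn r

  det-∷-+ : ∀ {k} (a : Vector Carrier (suc k)) {A B C : Matrix k (suc k)} →
    (∀ j → det k (λ r c → A r (punchIn j c)) ≈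
           det k (λ r c → B r (punchIn j c)) + det k (λ r c → C r (punchIn j c))) →
    det (suc k) (a ∷ A) ≈ det (suc k) (a ∷ B) + det (suc k) (a ∷ C)
  det-∷-+ a A≈B+C = trans
    (altSum-cong λ j → trans (*-congˡ (A≈B+C j)) (distribˡ _ _ _))
    (altSum-+ _ _)

  -- With row `r` moved to the front all four matrices share the rows below it, and additivity in
  -- the top row carries the relation between rows over to determinants.
  det-parallelogram : ∀ {k} (P Q S T : Matrix k k) r →
    (∀ {i} → i ≢ r → ∀ j → (Q i j ≈ P i j) × (S i j ≈ P i j) × (T i j ≈ P i j)) →
    (∀ j → P r j + Q r j ≈ S r j + T r j) →
    det k P + det k Q ≈ det k S + det k T
  det-parallelogram {suc k} P Q S T r off on = begin
    det _ P + det _ Q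
      ≈⟨ +-cong (front P λ _ _ → refl) (front Q λ i≢r → proj₁ ∘ off i≢r) ⟩
    sgn r * det _ (P r ∷ P′) + sgn r * det _ (Q r ∷ P′)
      ≈⟨ combine (P r) (Q r) ⟩
    sgn r * det _ ((λ j → P r j + Q r j) ∷ P′)
      ≈⟨ *-congˡ (det-cong _ (∷-cong {A = P′} on (λ _ _ → refl))) ⟩
    sgn r * det _ ((λ j → S r j + T r j) ∷ P′)
      ≈⟨ combine (S r) (T r) ⟨
    sgn r * det _ (S r ∷ P′) + sgn r * det _ (T r ∷ P′)
      ≈⟨ +-cong (front S λ i≢r → proj₁ ∘ proj₂ ∘ off i≢r)
           (front T λ i≢r → proj₂ ∘ proj₂ ∘ off i≢r) ⟨
    det _ S + det _ T ∎
    where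
    P′ : Matrix k (suc k)
    P′ = P ∘ punchIn r
    front : ∀ X → (∀ {i} → i ≢ r → ∀ j → X i j ≈ P i j) → det _ X ≈ sgn r * det _ (X r ∷ P′)
    front X X≈P = trans (det-moveToFront X r)
      (*-congˡ (det-cong _ (∷-cong {a = X r} (λ _ → refl) λ i → X≈P (punchInᵢ≢i r i))))
    combine : ∀ a b → sgn r * det _ (a ∷ P′) + sgn r * det _ (b ∷ P′) ≈
      sgn r * det _ ((λ j → a j + b j) ∷ P′)
    combine a b = trans (sym (distribˡ _ _ _)) (*-congˡ (sym (det-row₀-+ a b P′)))

-- Triples of distinct rows.

data Distinct₃ : ∀ {n} → Fin n → Fin n → Fin n → Set where
  distinct₃ : ∀ {n} (p : Fin (3 ℕ.+ n)) q r →
    Distinct₃ p (punchIn p q) (punchIn p (punchIn q r))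

-- `Distinct₃` presents the rows in the form that `det-move₃ToFront` takes; each later index is
-- pulled back by `punchOut` past the earlier ones.
distinct⇒Distinct₃ : ∀ {n} {p q r : Fin n} → p ≢ q → p ≢ r → q ≢ r → Distinct₃ p q r
distinct⇒Distinct₃ {suc zero} {zero} {zero} p≢q _ _ = contradiction ≡.refl p≢q
distinct⇒Distinct₃ {suc (suc n)} {p} {q} {r} p≢q p≢r q≢r =
  ≡.subst₂ (Distinct₃ p) (punchIn-punchOut p≢q)
    (≡.trans (≡.cong (punchIn p) (punchIn-punchOut q′≢r′)) (punchIn-punchOut p≢r))
    (build p (punchOut p≢q) (punchOut q′≢r′))
  where
  build : ∀ {n} (p : Fin (suc (suc n))) (q : Fin (suc n)) (r : Fin n) →
    Distinct₃ p (punchIn p q) (punchIn p (punchIn q r))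
  -- The case `zero` is void, as the third index would lie in `Fin zero`.
  build {suc n} = distinct₃
  q′≢r′ : punchOut p≢q ≢ punchOut p≢r
  q′≢r′ q′≡r′ = q≢r (≡.trans (≡.sym (punchIn-punchOut p≢q))
    (≡.trans (≡.cong (punchIn p) q′≡r′) (punchIn-punchOut p≢r)))

-- e₂(x, y, z, 1) on bits.
triangle : Bool → Bool → Bool → ℕ
triangle false false false = 0
triangle true  false false = 1
triangle false true  false = 1
triangle false false true  = 1
triangle true  true  false = 3
triangle true  false true  = 3
triangle false true  true  = 3
triangle true  true  true  = 6

-- The discriminant obstruction.

module Obstruction (R : CommutativeRing 0ℓ 0ℓ) where
  open CommutativeRing R hiding (zero)
  open RingProperties ring
  open import Relation.Binary.Reasoning.Setoid setoid
  open NatSolver commutativeSemiring using (solve; con; _:=_; _:+_; _:*_)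
  open SemiringMult semiring using (×-homo-+; ×1-homo-*) renaming (_×_ to _×ⁿ_)

  # : ℕ → Carrier
  # n = n ×ⁿ 1#

  -- Differences are read off by cancellation, with the minuend already split as `m + n`; no
  -- truncated subtraction of naturals arises.
  #-cancel : ∀ m n {x y} → x + y ≈ # (m ℕ.+ n) → y ≈ # n → x ≈ # m
  #-cancel m n {x} {y} x+y y≈n = +-cancelʳ (# n) x (# m) (begin
    x + # n     ≈⟨ +-congˡ y≈n ⟨
    x + y       ≈⟨ x+y ⟩
    # (m ℕ.+ n) ≈⟨ ×-homo-+ 1# m n ⟩
    # m + # n   ∎)

  -- An abstract form of the determinant as a function of three rows, the others being fixed. `u`,
  -- `v`, `w` are the rows at bit 0, and `e₁`, `e₂`, `e₃` their increments at bit 1.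
  module _ {V : Set} (_+ᵛ_ : V → V → V) (φ : V → V → V → Carrier)
    (φ-+₁ : ∀ p q s t → φ (p +ᵛ q) s t ≈ φ p s t + φ q s t)
    (φ-+₂ : ∀ p q s t → φ s (p +ᵛ q) t ≈ φ s p t + φ s q t)
    (φ-+₃ : ∀ p q s t → φ s t (p +ᵛ q) ≈ φ s t p + φ s t q)
    (φ-plücker : ∀ a b u v t → φ a b t * φ u v t + φ a u t * φ v b t ≈ φ a v t * φ u b t)
    (e₁ e₂ e₃ u v w : V)
    (φ-value : ∀ x y z →
      φ (if x then e₁ +ᵛ u else u) (if y then e₂ +ᵛ v else v) (if z then e₃ +ᵛ w else w)
        ≈ # (triangle x y z))
    where

    private
      w⟨_⟩ : Bool → V
      w⟨ z ⟩ = if z then e₃ +ᵛ w else w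

      -- Additivity turns partial derivatives into differences: `m + n` is the value at bit 1, `n`
      -- that at bit 0, `m` the derivative.
      ∂₁ : ∀ m n {p q s t} → φ (p +ᵛ q) s t ≈ # (m ℕ.+ n) → φ q s t ≈ # n → φ p s t ≈ # m
      ∂₁ m n eq = #-cancel m n (trans (sym (φ-+₁ _ _ _ _)) eq)

      ∂₂ : ∀ m n {p q s t} → φ s (p +ᵛ q) t ≈ # (m ℕ.+ n) → φ s q t ≈ # n → φ s p t ≈ # m
      ∂₂ m n eq = #-cancel m n (trans (sym (φ-+₂ _ _ _ _)) eq)

      ∂₃ : ∀ m n {p q s t} → φ s t (p +ᵛ q) ≈ # (m ℕ.+ n) → φ s t q ≈ # n → φ s t p ≈ # m
      ∂₃ m n eq = #-cancel m n (trans (sym (φ-+₃ _ _ _ _)) eq)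

      -- The numerals from here on come from f = e₂(x, y, z, 1): its x-derivative is y + z + 1, its
      -- y-derivative x + z + 1, and the mixed one 1.
      φ-e₁v : ∀ z → φ e₁ v w⟨ z ⟩ ≈ # (if z then 2 else 1)
      φ-e₁v false = ∂₁ 1 0 (φ-value true false false) (φ-value false false false)
      φ-e₁v true  = ∂₁ 2 1 (φ-value true false true) (φ-value false false true)

      φ-e₁v′ : ∀ z → φ e₁ (e₂ +ᵛ v) w⟨ z ⟩ ≈ # (if z then 3 else 2)
      φ-e₁v′ false = ∂₁ 2 1 (φ-value true true false) (φ-value false true false)
      φ-e₁v′ true  = ∂₁ 3 3 (φ-value true true true) (φ-value false true true)

      φ-ue₂ : ∀ z → φ u e₂ w⟨ z ⟩ ≈ # (if z then 2 else 1)
      φ-ue₂ false = ∂₂ 1 0 (φ-value false true false) (φ-value false false false)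
      φ-ue₂ true  = ∂₂ 2 1 (φ-value false true true) (φ-value false false true)

      φ-e₁e₂ : ∀ z → φ e₁ e₂ w⟨ z ⟩ ≈ # 1
      φ-e₁e₂ false = ∂₂ 1 1 (φ-e₁v′ false) (φ-e₁v false)
      φ-e₁e₂ true  = ∂₂ 1 2 (φ-e₁v′ true) (φ-e₁v true)

      G H : V → Carrier
      G t = φ e₁ u t
      H t = φ v e₂ t

      -- The Plücker relation for `e₁`, `e₂`, `u`, `v` reads f₀ f₁ - f f₀₁ = `G t * H t`, and `d` is
      -- the number m n - k l.
      GH : ∀ {t} k l m n d → φ e₁ e₂ t ≈ # k → φ u v t ≈ # l → φ e₁ v t ≈ # m → φ u e₂ t ≈ # n →
        m ℕ.* n ≡ d ℕ.+ k ℕ.* l → G t * H t ≈ # d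
      GH {t} k l m n d k≈ l≈ m≈ n≈ mn≡d+kl = #-cancel d (k ℕ.* l)
        (begin
          G t * H t + φ e₁ e₂ t * φ u v t ≈⟨ +-comm _ _ ⟩
          φ e₁ e₂ t * φ u v t + G t * H t ≈⟨ φ-plücker _ _ _ _ _ ⟩
          φ e₁ v t * φ u e₂ t             ≈⟨ *-cong m≈ n≈ ⟩
          # m * # n                       ≈⟨ ×1-homo-* m n ⟨
          # (m ℕ.* n)                     ≡⟨ ≡.cong # mn≡d+kl ⟩
          # (d ℕ.+ k ℕ.* l)               ∎)
        (trans (*-cong k≈ l≈) (sym (×1-homo-* k l)))

      -- This and the next two give the constant coefficient, the leading coefficient and the value
      -- at 1 of 1 + z + z².
      GH-w : G w * H w ≈ # 1
      GH-w = GH 1 0 1 1 1 (φ-e₁e₂ false) (φ-value false false false)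
        (φ-e₁v false) (φ-ue₂ false) ≡.refl

      GH-e₃ : G e₃ * H e₃ ≈ # 1
      GH-e₃ = GH 0 1 1 1 1 (∂₃ 0 1 (φ-e₁e₂ true) (φ-e₁e₂ false))
        (∂₃ 1 0 (φ-value false false true) (φ-value false false false))
        (∂₃ 1 1 (φ-e₁v true) (φ-e₁v false)) (∂₃ 1 1 (φ-ue₂ true) (φ-ue₂ false)) ≡.refl

      GH-e₃+w : G (e₃ +ᵛ w) * H (e₃ +ᵛ w) ≈ # 3
      GH-e₃+w = GH 1 1 2 2 3 (φ-e₁e₂ true) (φ-value false false true)
        (φ-e₁v true) (φ-ue₂ true) ≡.refl

      -- The two summands of the middle coefficient of (`G w` + z `G e₃`)(`H w` + z `H e₃`). Their
      -- sum is 3 - 1 - 1, and their product is that of the outer coefficients.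
      X Y : Carrier
      X = G w * H e₃
      Y = G e₃ * H w

      X+Y : X + Y ≈ # 1
      X+Y = #-cancel 1 2 (begin
        (X + Y) + # 2
          ≈⟨ +-congˡ (trans (×-homo-+ 1# 1 1) (+-cong (sym GH-e₃) (sym GH-w))) ⟩
        (X + Y) + (G e₃ * H e₃ + G w * H w)
          ≈⟨ solve 4 (λ g h g′ h′ → (g :* h′ :+ g′ :* h) :+ (g′ :* h′ :+ g :* h)
               := (g′ :+ g) :* (h′ :+ h)) refl _ _ _ _ ⟩
        (G e₃ + G w) * (H e₃ + H w)
          ≈⟨ *-cong (φ-+₃ _ _ _ _) (φ-+₃ _ _ _ _) ⟨
        G (e₃ +ᵛ w) * H (e₃ +ᵛ w)
          ≈⟨ GH-e₃+w ⟩
        # 3 ∎) refl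

      XY : X * Y ≈ # 1
      XY = begin
        X * Y
          ≈⟨ solve 4 (λ g h g′ h′ → (g :* h′) :* (g′ :* h) := (g :* h) :* (g′ :* h′))
               refl _ _ _ _ ⟩
        (G w * H w) * (G e₃ * H e₃) ≈⟨ *-cong GH-w GH-e₃ ⟩
        # 1 * # 1                   ≈⟨ *-identityˡ _ ⟩
        # 1                         ∎

    -- Along w + z e₃ the product G H is 1 + z + z², whose discriminant is therefore a square.
    minus3-square : Σ Carrier λ y → y * y ≈ - (1# + 1# + 1#)
    -- The identity behind this is D² + 4 X Y = (X + Y)². Adding 1 to both sides makes 3 into 4 = 4
    -- X Y, and writing `X` as `D + Y` leaves no subtraction for the solver.
    minus3-square = D , +-inverseˡ-unique _ _ (+-cancelʳ 1# _ _ (begin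
      (D * D + (1# + 1# + 1#)) + 1#
        ≈⟨ solve 2 (λ d o → (d :* d :+ (o :+ o :+ o)) :+ o := d :* d :+ con 4 :* o) refl _ _ ⟩
      D * D + # 4 * 1#
        ≈⟨ +-congˡ (*-congˡ (trans (sym XY) (*-congʳ X≈D+Y))) ⟩
      D * D + # 4 * ((D + Y) * Y)
        ≈⟨ solve 2 (λ d y → d :* d :+ con 4 :* ((d :+ y) :* y)
             := ((d :+ y) :+ y) :* ((d :+ y) :+ y)) refl _ _ ⟩
      ((D + Y) + Y) * ((D + Y) + Y)
        ≈⟨ *-cong D+2Y≈1 D+2Y≈1 ⟩
      1# * 1#
        ≈⟨ trans (*-identityˡ 1#) (sym (+-identityˡ 1#)) ⟩
      0# + 1# ∎))
      where
      D : Carrier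
      D = X - Y
      X≈D+Y : X ≈ D + Y
      X≈D+Y = sym (trans (+-assoc X (- Y) Y) (trans (+-congˡ (-‿inverseˡ Y)) (+-identityʳ X)))
      D+2Y≈1 : (D + Y) + Y ≈ 1#
      D+2Y≈1 = trans (+-congʳ (sym X≈D+Y)) X+Y

  module D = Determinant R
  open D using (Matrix; det)

  module _ (¼ : Carrier) (4*¼≈1 : # 4 * ¼ ≈ 1#) where

    #4≉0 : ¬ (1# ≈ 0#) → ¬ (# 4 ≈ 0#)
    #4≉0 1≉0 4≈0 = 1≉0 (trans (sym 4*¼≈1) (trans (*-congʳ 4≈0) (zeroˡ ¼)))

    -- Once the three rows are in front, the remaining ones are constant by locality, and the
    -- rescaled determinant is a trilinear form to which `minus3-square` applies.
    readOnceRows⇒minus3-square : ∀ {k} {p q r : Fin k} → Distinct₃ p q r →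
      (N : Vector Bool 3 → Matrix k k) →
      (∀ χ χ′ i → (i ≡ p → χ 0F ≡ χ′ 0F) → (i ≡ q → χ 1F ≡ χ′ 1F) → (i ≡ r → χ 2F ≡ χ′ 2F) →
        ∀ c → N χ i c ≈ N χ′ i c) →
      (∀ x y z → det k (N (x ∷ y ∷ z ∷ [])) ≈ # (4 ℕ.* triangle x y z)) →
      Σ Carrier λ y → y * y ≈ - (1# + 1# + 1#)
    readOnceRows⇒minus3-square (distinct₃ {k} p q₀ r₀) N local value =
      minus3-square _+ᵛ_ φ φ-+₁ φ-+₂ φ-+₃ φ-plücker
        e₁ e₂ e₃ u v w φ-value
      where
      V = Vector Carrier (3 ℕ.+ k)
      _+ᵛ_ : V → V → V
      (s +ᵛ t) j = s j + t j
      𝟎 : Vector Bool 3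
      𝟎 = false ∷ false ∷ false ∷ []
      q r : Fin (3 ℕ.+ k)
      q = punchIn p q₀
      r = punchIn p (punchIn q₀ r₀)
      rest : Fin k → Fin (3 ℕ.+ k)
      rest i = punchIn p (punchIn q₀ (punchIn r₀ i))
      R₀ : Matrix k (3 ℕ.+ k)
      R₀ = N 𝟎 ∘ rest
      u v w : V
      u = N 𝟎 p
      v = N 𝟎 q
      w = N 𝟎 r
      ε : Carrier
      ε = D.sgn p * (D.sgn q₀ * D.sgn r₀)
      -- `ε` is the sign of moving the three rows to the front, and `¼` removes the factor 4 of the
      -- permanent.
      φ : V → V → V → Carrier
      φ s t t′ = (¼ * ε) * det _ (s ∷ t ∷ t′ ∷ R₀)
      scale-+ : ∀ {x y z} → x ≈ y + z → (¼ * ε) * x ≈ (¼ * ε) * y + (¼ * ε) * z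
      scale-+ x≈y+z = trans (*-congˡ x≈y+z) (distribˡ _ _ _)
      φ-+₁ : ∀ p q s t → φ (p +ᵛ q) s t ≈ φ p s t + φ q s t
      φ-+₁ a b s t = scale-+ (D.det-row₀-+ a b (s ∷ t ∷ R₀))
      φ-+₂ : ∀ p q s t → φ s (p +ᵛ q) t ≈ φ s p t + φ s q t
      φ-+₂ a b s t = scale-+ (D.det-∷-+ s {(a +ᵛ b) ∷ t ∷ R₀} {a ∷ t ∷ R₀} {b ∷ t ∷ R₀} λ j →
        D.det-row₀-+ (a ∘ punchIn j) (b ∘ punchIn j) (λ r c → (t ∷ R₀) r (punchIn j c)))
      φ-+₃ : ∀ p q s t → φ s t (p +ᵛ q) ≈ φ s t p + φ s t q
      φ-+₃ a b s t = scale-+ (D.det-∷-+ s {t ∷ (a +ᵛ b) ∷ R₀} {t ∷ a ∷ R₀} {t ∷ b ∷ R₀} λ j →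
        D.det-∷-+ (t ∘ punchIn j) {λ r c → ((a +ᵛ b) ∷ R₀) r (punchIn j c)}
          {λ r c → (a ∷ R₀) r (punchIn j c)} {λ r c → (b ∷ R₀) r (punchIn j c)} λ j′ →
          D.det-row₀-+ (a ∘ punchIn j ∘ punchIn j′) (b ∘ punchIn j ∘ punchIn j′)
            (λ r c → R₀ r (punchIn j (punchIn j′ c))))
      φ-plücker : ∀ a b u v t → φ a b t * φ u v t + φ a u t * φ v b t ≈ φ a v t * φ u b t
      φ-plücker a b u v t = begin
        φ a b t * φ u v t + φ a u t * φ v b t
          -- Every term is quadratic in `φ`, so the scalar factors out squared.
          ≈⟨ solve 5 (λ s x y z o → (s :* x) :* (s :* y) :+ (s :* z) :* (s :* o)
               := (s :* s) :* (x :* y :+ z :* o)) refl (¼ * ε) _ _ _ _ ⟩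
        ((¼ * ε) * (¼ * ε)) * (_ * _ + _ * _)
          ≈⟨ *-congˡ (D.plücker a b u v (t ∷ R₀)) ⟩
        ((¼ * ε) * (¼ * ε)) * (_ * _)
          ≈⟨ solve 3 (λ s x y → (s :* s) :* (x :* y) := (s :* x) :* (s :* y)) refl (¼ * ε) _ _ ⟩
        φ a v t * φ u b t ∎
      p≢q : p ≢ q
      p≢q = punchInᵢ≢i p q₀ ∘ ≡.sym
      p≢r : p ≢ r
      p≢r = punchInᵢ≢i p _ ∘ ≡.sym
      q≢r : q ≢ r
      q≢r = punchInᵢ≢i q₀ _ ∘ ≡.sym ∘ punchIn-injective p _ _
      rest≢p : ∀ i → rest i ≢ p
      rest≢p i = punchInᵢ≢i p _
      rest≢q : ∀ i → rest i ≢ q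
      rest≢q i = punchInᵢ≢i q₀ _ ∘ punchIn-injective p _ _
      rest≢r : ∀ i → rest i ≢ r
      rest≢r i = punchInᵢ≢i r₀ _ ∘ punchIn-injective q₀ _ _ ∘ punchIn-injective p _ _
      x-y+y : ∀ x y → x - y + y ≈ x
      x-y+y x y = trans (+-assoc x (- y) y) (trans (+-congˡ (-‿inverseˡ y)) (+-identityʳ x))
      e₁ e₂ e₃ : V
      -- Only values at bits are available, so the increment is a difference of rows; by locality
      -- the other two bits do not affect it.
      e₁ c = N (true ∷ false ∷ false ∷ []) p c - u c
      e₂ c = N (false ∷ true ∷ false ∷ []) q c - v c
      e₃ c = N (false ∷ false ∷ true ∷ []) r c - w c
      u⟨_⟩ v⟨_⟩ w⟨_⟩ : Bool → V
      u⟨ x ⟩ = if x then e₁ +ᵛ u else u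
      v⟨ y ⟩ = if y then e₂ +ᵛ v else v
      w⟨ z ⟩ = if z then e₃ +ᵛ w else w
      row-p : ∀ x y z c → N (x ∷ y ∷ z ∷ []) p c ≈ u⟨ x ⟩ c
      row-p false y z = local _ _ p (λ _ → ≡.refl) (⊥-elim ∘ p≢q) (⊥-elim ∘ p≢r)
      row-p true  y z c = trans
        (local _ _ p (λ _ → ≡.refl) (⊥-elim ∘ p≢q) (⊥-elim ∘ p≢r) c) (sym (x-y+y _ _))
      row-q : ∀ x y z c → N (x ∷ y ∷ z ∷ []) q c ≈ v⟨ y ⟩ c
      row-q x false z = local _ _ q (⊥-elim ∘ p≢q ∘ ≡.sym) (λ _ → ≡.refl) (⊥-elim ∘ q≢r)
      row-q x true  z c = trans
        (local _ _ q (⊥-elim ∘ p≢q ∘ ≡.sym) (λ _ → ≡.refl) (⊥-elim ∘ q≢r) c) (sym (x-y+y _ _))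
      row-r : ∀ x y z c → N (x ∷ y ∷ z ∷ []) r c ≈ w⟨ z ⟩ c
      row-r x y false = local _ _ r (⊥-elim ∘ p≢r ∘ ≡.sym) (⊥-elim ∘ q≢r ∘ ≡.sym) (λ _ → ≡.refl)
      row-r x y true  c = trans
        (local _ _ r (⊥-elim ∘ p≢r ∘ ≡.sym) (⊥-elim ∘ q≢r ∘ ≡.sym) (λ _ → ≡.refl) c)
        (sym (x-y+y _ _))
      front : Vector Bool 3 → Matrix (3 ℕ.+ k) (3 ℕ.+ k)
      front χ = N χ p ∷ N χ q ∷ N χ r ∷ N χ ∘ rest
      front≈ : ∀ x y z i j →
        front (x ∷ y ∷ z ∷ []) i j ≈ (u⟨ x ⟩ ∷ v⟨ y ⟩ ∷ w⟨ z ⟩ ∷ R₀) i j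
      front≈ x y z = D.∷-cong (row-p x y z) (D.∷-cong (row-q x y z) (D.∷-cong (row-r x y z)
        λ i → local _ _ (rest i)
          (⊥-elim ∘ rest≢p i) (⊥-elim ∘ rest≢q i) (⊥-elim ∘ rest≢r i)))
      φ-value : ∀ x y z → φ u⟨ x ⟩ v⟨ y ⟩ w⟨ z ⟩ ≈ # (triangle x y z)
      φ-value x y z = begin
        φ u⟨ x ⟩ v⟨ y ⟩ w⟨ z ⟩
          ≈⟨ *-congˡ (D.det-cong _ (front≈ x y z)) ⟨
        (¼ * ε) * det _ (front χ)
          ≈⟨ *-assoc ¼ ε _ ⟩
        ¼ * (ε * det _ (front χ))
          ≈⟨ *-congˡ (D.det-move₃ToFront (N χ) p q₀ r₀) ⟨
        ¼ * det _ (N χ)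
          ≈⟨ *-congˡ (trans (value x y z) (×1-homo-* 4 (triangle x y z))) ⟩
        ¼ * (# 4 * # (triangle x y z))
          ≈⟨ solve 3 (λ a b c → a :* (b :* c) := (b :* a) :* c) refl _ _ _ ⟩
        (# 4 * ¼) * # (triangle x y z)
          ≈⟨ trans (*-congʳ 4*¼≈1) (*-identityˡ _) ⟩
        # (triangle x y z) ∎
        where
        χ = x ∷ y ∷ z ∷ []

-- The substitution into the permanent.

perm : ∀ k → (Fin k → Fin k → ℕ) → ℕ
perm zero    A = 1
perm (suc k) A = sum (λ j → A zero j ℕ.* perm k (λ r c → A (suc r) (punchIn j c)))

-- `inj₁ t` keeps a variable xₜ; `inj₂ a` substitutes the constant a.
Slot : Set
Slot = Fin 3 ⊎ ℕ

-- The permanent of this 6 × 6 block is 4 e₂(x₀, x₁, x₂, 1): a 2-subset of the first four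
-- diagonal entries is completed in 2 · 2 ways through the two blocks of ones.
slot₆ : Fin 6 → Fin 6 → Slot
slot₆ i j = lookup (lookup table i) j
  where
  x y z l o : Slot
  x = inj₁ 0F
  y = inj₁ 1F
  z = inj₁ 2F
  l = inj₂ 1
  o = inj₂ 0
  infixr 5 _▸_
  _▸_ : ∀ {A : Set} {n} → A → Vec A n → Vec A (suc n)
  _▸_ = Vec._∷_
  table : Vec (Vec Slot 6) 6
  table = (x ▸ o ▸ o ▸ o ▸ l ▸ l ▸ Vec.[])
        ▸ (o ▸ y ▸ o ▸ o ▸ l ▸ l ▸ Vec.[])
        ▸ (o ▸ o ▸ z ▸ o ▸ l ▸ l ▸ Vec.[])
        ▸ (o ▸ o ▸ o ▸ l ▸ l ▸ l ▸ Vec.[])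
        ▸ (l ▸ l ▸ l ▸ l ▸ o ▸ o ▸ Vec.[])
        ▸ (l ▸ l ▸ l ▸ l ▸ o ▸ o ▸ Vec.[])
        ▸ Vec.[]

-- An identity block of size `m` precedes the 6 × 6 block and leaves its permanent unchanged.
slot : ∀ m → Fin (m ℕ.+ 6) → Fin (m ℕ.+ 6) → Slot
slot zero    i       j       = slot₆ i j
slot (suc m) zero    zero    = inj₂ 1
slot (suc m) zero    (suc _) = inj₂ 0
slot (suc m) (suc _) zero    = inj₂ 0
slot (suc m) (suc i) (suc j) = slot m i j

diagonal₆ : Fin 3 → Fin 6
diagonal₆ t = t ↑ˡ 3

slot-diagonal : ∀ m i j {t} → slot m i j ≡ inj₁ t →
  (i ≡ m ↑ʳ diagonal₆ t) × (j ≡ m ↑ʳ diagonal₆ t)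
slot-diagonal zero i j {t} = slot₆-diagonal i j t
  where
  slot₆-diagonal : ∀ i j t → slot₆ i j ≡ inj₁ t → (i ≡ diagonal₆ t) × (j ≡ diagonal₆ t)
  slot₆-diagonal = from-yes (all? λ i → all? λ j → all? λ t →
    Sum.≡-dec _≟_ ℕ._≟_ (slot₆ i j) (inj₁ t) →-dec
    ((i ≟ diagonal₆ t) ×-dec (j ≟ diagonal₆ t)))
slot-diagonal (suc m) zero    zero    ()
slot-diagonal (suc m) zero    (suc _) ()
slot-diagonal (suc m) (suc _) zero    ()
slot-diagonal (suc m) (suc i) (suc j) eq =
  let i≡ , j≡ = slot-diagonal m i j eq in ≡.cong suc i≡ , ≡.cong suc j≡

-- Each xₜ replaces a single variable of the permanent, so being read-once survives the
-- substitution.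
slot-injective : ∀ m {t} i j i′ j′ → slot m i j ≡ inj₁ t → slot m i′ j′ ≡ inj₁ t →
  (i ≡ i′) × (j ≡ j′)
slot-injective m i j i′ j′ ij i′j′ =
  let i≡ , j≡ = slot-diagonal m i j ij ; i′≡ , j′≡ = slot-diagonal m i′ j′ i′j′
  in ≡.trans i≡ (≡.sym i′≡) , ≡.trans j≡ (≡.sym j′≡)

bit : Bool → ℕ
bit b = if b then 1 else 0

value : Vector Bool 3 → Slot → ℕ
value χ = [ bit ∘ χ , id ]′

perm-slot : ∀ m x y z →
  perm (m ℕ.+ 6) (λ i j → value (x ∷ y ∷ z ∷ []) (slot m i j)) ≡ 4 ℕ.* triangle x y z
perm-slot zero false false false = ≡.refl
perm-slot zero true  false false = ≡.refl
perm-slot zero false true  false = ≡.refl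
perm-slot zero false false true  = ≡.refl
perm-slot zero true  true  false = ≡.refl
perm-slot zero true  false true  = ≡.refl
perm-slot zero false true  true  = ≡.refl
perm-slot zero true  true  true  = ≡.refl
perm-slot (suc m) x y z = begin
  -- The first row is 1, 0, ..., 0, and `p + 0` is `1 * p` unfolded.
  (p ℕ.+ 0) ℕ.+ sum {m ℕ.+ 6} (λ _ → 0)
    ≡⟨ ≡.cong₂ ℕ._+_ (ℕ.+-identityʳ p) (sum-replicate-zero (m ℕ.+ 6)) ⟩
  p ℕ.+ 0                               ≡⟨ ℕ.+-identityʳ p ⟩
  p                                     ≡⟨ perm-slot m x y z ⟩
  4 ℕ.* triangle x y z                  ∎
  where
  open ≡.≡-Reasoning
  p = perm (m ℕ.+ 6) (λ i j → value (x ∷ y ∷ z ∷ []) (slot m i j))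

-- Evaluation of polynomials at points.

module Evaluation (F : CommutativeRing 0ℓ 0ℓ) (n : ℕ) where
  open CommutativeRing F hiding (zero)
  open SemiringMult semiring using (×-homo-+; ×1-homo-*)
  open Determinant F
  open Obstruction F using (#)
  module P = Polynomials F n
  open P using (Poly; con; var; _⊕_; _⊗_; ⊝_; _≋_)

  eval : (Fin n → Fin n → Carrier) → Poly → Carrier
  eval ρ (con c)   = c
  eval ρ (var i j) = ρ i j
  eval ρ (p ⊕ q)   = eval ρ p + eval ρ q
  eval ρ (p ⊗ q)   = eval ρ p * eval ρ q
  eval ρ (⊝ p)     = - eval ρ p

  eval-cong : ∀ ρ {p q} → p ≋ q → eval ρ p ≈ eval ρ q
  eval-cong ρ P.≋-refl            = refl
  eval-cong ρ (P.≋-sym e)         = sym (eval-cong ρ e)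
  eval-cong ρ (P.≋-trans e f)     = trans (eval-cong ρ e) (eval-cong ρ f)
  eval-cong ρ (P.⊕-cong e f)      = +-cong (eval-cong ρ e) (eval-cong ρ f)
  eval-cong ρ (P.⊗-cong e f)      = *-cong (eval-cong ρ e) (eval-cong ρ f)
  eval-cong ρ (P.⊝-cong e)        = -‿cong (eval-cong ρ e)
  eval-cong ρ (P.⊕-assoc p q r)   = +-assoc _ _ _
  eval-cong ρ (P.⊕-comm p q)      = +-comm _ _
  eval-cong ρ (P.⊕-idˡ p)         = +-identityˡ _
  eval-cong ρ (P.⊝-invˡ p)        = -‿inverseˡ _
  eval-cong ρ (P.⊗-assoc p q r)   = *-assoc _ _ _
  eval-cong ρ (P.⊗-comm p q)      = *-comm _ _
  eval-cong ρ (P.⊗-idˡ p)         = *-identityˡ _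
  eval-cong ρ (P.distrib p q r)   = distribˡ _ _ _
  eval-cong ρ (P.con-≈ a≈b)       = a≈b
  eval-cong ρ (P.con-+ a b)       = refl
  eval-cong ρ (P.con-* a b)       = refl
  eval-cong ρ (P.con-neg a)       = refl

  eval-altSum : ∀ ρ {k} (f : Fin k → Poly) → eval ρ (P.altSum f) ≈ altSum (eval ρ ∘ f)
  eval-altSum ρ {zero}  f = sym (altSum-zero {f = eval ρ ∘ f} λ ())
  eval-altSum ρ {suc k} f =
    trans (+-congˡ (-‿cong (eval-altSum ρ (f ∘ suc)))) (sym (altSum-suc (eval ρ ∘ f)))

  eval-det : ∀ ρ k (M : Fin k → Fin k → Poly) →
    eval ρ (P.det k M) ≈ det k (λ r c → eval ρ (M r c))
  eval-det ρ zero    M = refl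
  eval-det ρ (suc k) M = trans
    (eval-altSum ρ (λ j → M zero j ⊗ P.det k (P.minor M j)))
    (altSum-cong λ j → *-congˡ (eval-det ρ k (P.minor M j)))

  eval-sum : ∀ ρ {k} (f : Fin k → Poly) (g : Fin k → ℕ) → (∀ j → eval ρ (f j) ≈ # (g j)) →
    eval ρ (P.sum f) ≈ # (sum g)
  eval-sum ρ {zero}  f g f≈g = refl
  eval-sum ρ {suc k} f g f≈g = trans
    (+-cong (f≈g zero) (eval-sum ρ (f ∘ suc) (g ∘ suc) (f≈g ∘ suc)))
    (sym (×-homo-+ 1# (g zero) _))

  -- At points with natural coordinates the permanent is the image of one over ℕ, which computes
  -- although the field is abstract.
  eval-perm : ∀ ρ k (M : Fin k → Fin k → Poly) (A : Fin k → Fin k → ℕ) →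
    (∀ i j → eval ρ (M i j) ≈ # (A i j)) → eval ρ (P.perm k M) ≈ # (perm k A)
  eval-perm ρ zero    M A M≈A = refl
  eval-perm ρ (suc k) M A M≈A = eval-sum ρ {suc k} (λ j → M zero j ⊗ P.perm k (P.minor M j))
    (λ j → A zero j ℕ.* perm k (λ r c → A (suc r) (punchIn j c))) λ j → trans
    (*-cong (M≈A zero j) (eval-perm ρ k (P.minor M j) _ λ r c → M≈A (suc r) (punchIn j c)))
    (sym (×1-homo-* (A zero j) _))

-- Bit patterns supported on one or two variables.

unit : Fin 3 → Vector Bool 3
unit t s = does (s ≟ t)

-- The corners of the square spanned by two coordinates, with the remaining bit 0.
units : Bool → Bool → Fin 3 → Fin 3 → Vector Bool 3
units a b t t′ s = (a ∧ unit t s) ∨ (b ∧ unit t′ s)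

triangle₃ : Vector Bool 3 → ℕ
triangle₃ χ = triangle (χ 0F) (χ 1F) (χ 2F)

units-bit : ∀ t t′ → t ≢ t′ → ∀ s →
  bit (units true true t t′ s) ℕ.+ bit (units false false t t′ s) ≡
  bit (units true false t t′ s) ℕ.+ bit (units false true t t′ s)
units-bit = from-yes (all? λ t → all? λ t′ → ¬? (t ≟ t′) →-dec all? λ s →
  bit (units true true t t′ s) ℕ.+ bit (units false false t t′ s) ℕ.≟
  bit (units true false t t′ s) ℕ.+ bit (units false true t t′ s))

-- The extra 1 is the mixed second difference of e₂, the coefficient of the product of the two
-- variables.
units-triangle : ∀ t t′ → t ≢ t′ →
  triangle₃ (units true true t t′) ℕ.+ triangle₃ (units false false t t′) ≡
  suc (triangle₃ (units true false t t′) ℕ.+ triangle₃ (units false true t t′))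
units-triangle = from-yes (all? λ t → all? λ t′ → ¬? (t ≟ t′) →-dec
  (triangle₃ (units true true t t′) ℕ.+ triangle₃ (units false false t t′) ℕ.≟
   suc (triangle₃ (units true false t t′) ℕ.+ triangle₃ (units false true t t′))))

units-off : ∀ a b t t′ {s} → s ≢ t → s ≢ t′ → units a b t t′ s ≡ false
units-off a b t t′ {s} s≢t s≢t′ = ≡.cong₂ _∨_
  (≡.trans (≡.cong (a ∧_) (dec-false (s ≟ t) s≢t)) (Bool.∧-zeroʳ a))
  (≡.trans (≡.cong (b ∧_) (dec-false (s ≟ t′) s≢t′)) (Bool.∧-zeroʳ b))

-- From a read-once determinant to three distinct rows.

module Reduction (F : CommutativeRing 0ℓ 0ℓ) (m k : ℕ) where
  n : ℕ
  n = m ℕ.+ 6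
  open CommutativeRing F hiding (zero)
  open RingProperties ring
  open import Relation.Binary.Reasoning.Setoid setoid
  open SemiringMult semiring using (×-homo-+; ×1-homo-*)
  open Determinant F
  open Obstruction F
  open Evaluation F n
  open P using (var; _≋_; Entry; evar; econst; toPoly; ReadOnce; Permₙ)

  module _ (M : Fin k → Fin k → Entry) (readOnce : ReadOnce M)
    (det-M : P.det k (λ r c → toPoly (M r c)) ≋ Permₙ)
    (1≉0 : ¬ (1# ≈ 0#)) (¼ : Carrier) (4*¼≈1 : # 4 * ¼ ≈ 1#) where

    ρ : Vector Bool 3 → Fin n → Fin n → Carrier
    ρ χ i j = # (value χ (slot m i j))

    spec : Entry → Fin 3 ⊎ Carrier
    spec (evar i j) = map₂ # (slot m i j)
    spec (econst c) = inj₂ c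

    entry : Vector Bool 3 → Fin 3 ⊎ Carrier → Carrier
    entry χ = [ # ∘ bit ∘ χ , id ]′

    N : Vector Bool 3 → Matrix k k
    N χ r c = entry χ (spec (M r c))

    eval-entry : ∀ χ e → eval (ρ χ) (toPoly e) ≈ entry χ (spec e)
    eval-entry χ (evar i j) with slot m i j
    ... | inj₁ t = refl
    ... | inj₂ a = refl
    eval-entry χ (econst c) = refl

    -- Bit vectors are functions and agree with their listed values only pointwise, while
    -- `perm-slot` is stated for listed bits.
    value-η : ∀ χ s → value χ s ≡ value (χ 0F ∷ χ 1F ∷ χ 2F ∷ []) s
    value-η χ (inj₁ 0F) = ≡.refl
    value-η χ (inj₁ 1F) = ≡.refl
    value-η χ (inj₁ 2F) = ≡.refl
    value-η χ (inj₂ a)  = ≡.refl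

    -- The assumed polynomial identity, evaluated at the point `ρ χ`.
    det-N : ∀ χ → det k (N χ) ≈ # (4 ℕ.* triangle₃ χ)
    det-N χ = begin
      det k (N χ)
        ≈⟨ det-cong k (λ r c → eval-entry χ (M r c)) ⟨
      det k (λ r c → eval (ρ χ) (toPoly (M r c)))
        ≈⟨ eval-det (ρ χ) k _ ⟨
      eval (ρ χ) (P.det k (λ r c → toPoly (M r c)))
        ≈⟨ eval-cong (ρ χ) det-M ⟩
      eval (ρ χ) Permₙ
        ≈⟨ eval-perm (ρ χ) n var _ (λ i j → reflexive (≡.cong # (value-η χ (slot m i j)))) ⟩
      # (perm n (λ i j → value (χ 0F ∷ χ 1F ∷ χ 2F ∷ []) (slot m i j)))
        ≡⟨ ≡.cong # (perm-slot m (χ 0F) (χ 1F) (χ 2F)) ⟩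
      # (4 ℕ.* triangle₃ χ) ∎

    spec-var : ∀ e {t} → spec e ≡ inj₁ t →
      Σ (Fin n) λ i → Σ (Fin n) λ j → (e ≡ evar i j) × (slot m i j ≡ inj₁ t)
    spec-var (evar i j) eq with slot m i j in s≡
    spec-var (evar i j) ≡.refl | inj₁ t = i , j , ≡.refl , s≡

    -- Both entries come from the one variable of the permanent that xₜ replaces, so `readOnce`
    -- identifies their positions.
    row-unique : ∀ {t r c r′ c′} →
      spec (M r c) ≡ inj₁ t → spec (M r′ c′) ≡ inj₁ t → r ≡ r′
    row-unique {r = r} {c} {r′} {c′} rc r′c′
      with i , j , M≡ , s ← spec-var (M r c) rc
         | i′ , j′ , M′≡ , s′ ← spec-var (M r′ c′) r′c′
      with ≡.refl , ≡.refl ← slot-injective m i j i′ j′ s s′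
      = proj₁ (readOnce r c r′ c′ i j M≡ M′≡)

    N-local : ∀ χ χ′ r c → (∀ t → spec (M r c) ≡ inj₁ t → χ t ≡ χ′ t) → N χ r c ≈ N χ′ r c
    N-local χ χ′ r c agree with spec (M r c)
    ... | inj₁ t = reflexive (≡.cong (# ∘ bit) (agree t ≡.refl))
    ... | inj₂ a = refl

    4≉0 : ¬ (# 4 ≈ 0#)
    4≉0 = #4≉0 ¼ 4*¼≈1 1≉0

    occurs? : ∀ t → Dec (Σ (Fin k) λ r → Σ (Fin k) λ c → spec (M r c) ≡ inj₁ t)
    occurs? t = any? λ r → any? λ c → isVar? (spec (M r c))
      where
      -- Tags and indices in `Fin 3` suffice to decide this; elements of the field are never
      -- compared.
      isVar? : (s : Fin 3 ⊎ Carrier) → Dec (s ≡ inj₁ t)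
      isVar? (inj₁ t′) with t′ ≟ t
      ... | yes ≡.refl = yes ≡.refl
      ... | no  t′≢t   = no (t′≢t ∘ Sum.inj₁-injective)
      isVar? (inj₂ _) = no λ ()

    -- If xₜ occurred nowhere, the determinant would not notice its bit, yet it is 4 with only that
    -- bit set and 0 with none.
    row : ∀ t → Σ (Fin k) λ p → ∀ r c → spec (M r c) ≡ inj₁ t → r ≡ p
    row t with occurs? t
    ... | yes (p , c , pc) = p , λ r c′ rc′ → row-unique rc′ pc
    ... | no  ∄t           = ⊥-elim (4≉0 (begin
      # 4                      ≡⟨ ≡.cong (# ∘ (4 ℕ.*_)) (unit-triangle t) ⟨
      # (4 ℕ.* triangle₃ (unit t)) ≈⟨ det-N (unit t) ⟨
      det k (N (unit t))       ≈⟨ det-cong k (λ r c → N-local (unit t) (λ _ → false) r c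
                                    λ s rc → dec-false (s ≟ t)
                                      λ { ≡.refl → ∄t (r , c , rc) }) ⟩
      det k (N (λ _ → false))  ≈⟨ det-N (λ _ → false) ⟩
      0# ∎))
      where
      unit-triangle : ∀ t → triangle₃ (unit t) ≡ 1
      unit-triangle = from-yes (all? λ t → triangle₃ (unit t) ℕ.≟ 1)

    pos : Fin 3 → Fin k
    pos t = proj₁ (row t)

    N-parallelogram : ∀ χ₁ χ₂ χ₃ χ₄ r c →
      (∀ t → bit (χ₁ t) ℕ.+ bit (χ₂ t) ≡ bit (χ₃ t) ℕ.+ bit (χ₄ t)) →
      N χ₁ r c + N χ₂ r c ≈ N χ₃ r c + N χ₄ r c
    N-parallelogram χ₁ χ₂ χ₃ χ₄ r c bits with spec (M r c)
    ... | inj₂ a = refl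
    ... | inj₁ t = begin
      # (bit (χ₁ t)) + # (bit (χ₂ t))  ≈⟨ ×-homo-+ 1# (bit (χ₁ t)) _ ⟨
      # (bit (χ₁ t) ℕ.+ bit (χ₂ t))    ≡⟨ ≡.cong # (bits t) ⟩
      # (bit (χ₃ t) ℕ.+ bit (χ₄ t))    ≈⟨ ×-homo-+ 1# (bit (χ₃ t)) _ ⟩
      # (bit (χ₃ t)) + # (bit (χ₄ t))  ∎

    -- If two variables shared a row, the determinant would be additive in them.
    pos-injective : ∀ t t′ → t ≢ t′ → pos t ≢ pos t′
    -- The mixed second difference of the determinant is 4 by its values and 0 by additivity in the
    -- shared row.
    pos-injective t t′ t≢t′ pt≡pt′ = 4≉0 (+-cancelʳ (# (4 ℕ.* (b ℕ.+ c))) _ _ (begin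
      # 4 + # (4 ℕ.* (b ℕ.+ c))  ≈⟨ ×-homo-+ 1# 4 (4 ℕ.* (b ℕ.+ c)) ⟨
      # (4 ℕ.+ 4 ℕ.* (b ℕ.+ c))  ≡⟨ ≡.cong # (ℕ.*-suc 4 (b ℕ.+ c)) ⟨
      # (4 ℕ.* suc (b ℕ.+ c))    ≡⟨ ≡.cong (# ∘ (4 ℕ.*_)) (units-triangle t t′ t≢t′) ⟨
      # (4 ℕ.* (a ℕ.+ d))        ≈⟨ det-N₂ (units true true t t′) (units false false t t′) ⟨
      Δ true true + Δ false false
        ≈⟨ det-parallelogram _ _ _ _ (pos t)
             (λ i≢ j → off false false i≢ j , off true false i≢ j , off false true i≢ j)
             (λ j → N-parallelogram (units true true t t′) (units false false t t′)
               (units true false t t′) (units false true t t′) (pos t) j (units-bit t t′ t≢t′)) ⟩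
      Δ true false + Δ false true
        ≈⟨ det-N₂ (units true false t t′) (units false true t t′) ⟩
      # (4 ℕ.* (b ℕ.+ c))        ≈⟨ +-identityˡ _ ⟨
      0# + # (4 ℕ.* (b ℕ.+ c))   ∎))
      where
      a b c d : ℕ
      a = triangle₃ (units true true t t′)
      b = triangle₃ (units true false t t′)
      c = triangle₃ (units false true t t′)
      d = triangle₃ (units false false t t′)
      Δ : Bool → Bool → Carrier
      Δ x y = det k (N (units x y t t′))
      det-N₂ : ∀ χ χ′ → det k (N χ) + det k (N χ′) ≈ # (4 ℕ.* (triangle₃ χ ℕ.+ triangle₃ χ′))
      det-N₂ χ χ′ = begin
        det k (N χ) + det k (N χ′)
          ≈⟨ +-cong (det-N χ) (det-N χ′) ⟩
        # (4 ℕ.* triangle₃ χ) + # (4 ℕ.* triangle₃ χ′)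
          ≈⟨ ×-homo-+ 1# (4 ℕ.* triangle₃ χ) _ ⟨
        # (4 ℕ.* triangle₃ χ ℕ.+ 4 ℕ.* triangle₃ χ′)
          ≡⟨ ≡.cong # (ℕ.*-distribˡ-+ 4 (triangle₃ χ) _) ⟨
        # (4 ℕ.* (triangle₃ χ ℕ.+ triangle₃ χ′)) ∎
      -- Rows other than the shared one contain neither of the two variables.
      off : ∀ x y {i} → i ≢ pos t → ∀ j →
        N (units x y t t′) i j ≈ N (units true true t t′) i j
      off x y {i} i≢ j = N-local _ _ i j λ s ij →
        let s≢t  = λ s≡t → i≢ (≡.trans (proj₂ (row s) i j ij) (≡.cong pos s≡t))
            s≢t′ = λ s≡t′ → i≢ (≡.trans (proj₂ (row s) i j ij)
                     (≡.trans (≡.cong pos s≡t′) (≡.sym pt≡pt′)))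
        in ≡.trans (units-off x y t t′ s≢t s≢t′) (≡.sym (units-off true true t t′ s≢t s≢t′))

    readOnceDet⇒minus3-square : Σ Carrier λ y → y * y ≈ - (1# + 1# + 1#)
    readOnceDet⇒minus3-square = readOnceRows⇒minus3-square ¼ 4*¼≈1
      (distinct⇒Distinct₃ (pos-injective 0F 1F λ ()) (pos-injective 0F 2F λ ())
        (pos-injective 1F 2F λ ()))
      N local (λ x y z → det-N (x ∷ y ∷ z ∷ []))
      where
      local : ∀ χ χ′ i → (i ≡ pos 0F → χ 0F ≡ χ′ 0F) → (i ≡ pos 1F → χ 1F ≡ χ′ 1F) →
        (i ≡ pos 2F → χ 2F ≡ χ′ 2F) → ∀ c → N χ i c ≈ N χ′ i c
      local χ χ′ i eq₀ eq₁ eq₂ c = N-local χ χ′ i c λ where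
        0F ic → eq₀ (proj₂ (row 0F) i c ic)
        1F ic → eq₁ (proj₂ (row 1F) i c ic)
        2F ic → eq₂ (proj₂ (row 2F) i c ic)

-- The admissible fields and the conclusion.

module _ (F : CommutativeRing 0ℓ 0ℓ) where
  open CommutativeRing F hiding (zero)
  open RingProperties ring
  open import Relation.Binary.Reasoning.Setoid setoid
  open NatSolver commutativeSemiring using (solve; con; _:=_; _:+_; _:*_)

  -- Squares are nonnegative in an ordered field, so y² = -3 gives 1 ≤ 3 ≤ 0; together with 0 ≤ 1
  -- this forces 1 = 0.
  CompleteOrderedField⇒Minus3NonResidue : CompleteOrderedField F → Minus3NonResidue F
  CompleteOrderedField⇒Minus3NonResidue R (y , y²≈-3) = proj₁ isField (antisym 1≤0 0≤1)
    where
    open CompleteOrderedField R renaming (_≤_ to infix 4 _⊑_)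
    open IsTotalOrder isTotalOrder using (total; antisym; ≤-respˡ-≈; ≤-respʳ-≈)
      renaming (trans to ⊑-trans)
    0≤-x : ∀ {x} → x ⊑ 0# → 0# ⊑ - x
    0≤-x {x} x≤0 = ≤-respˡ-≈ (-‿inverseʳ x) (≤-respʳ-≈ (+-identityˡ (- x)) (+-mono x 0# (- x) x≤0))
    0≤x² : ∀ x → 0# ⊑ x * x
    0≤x² x with total 0# x
    ... | inj₁ 0≤x = *-nonneg x x 0≤x 0≤x
    ... | inj₂ x≤0 = ≤-respʳ-≈ -x*-x≈x*x (*-nonneg (- x) (- x) (0≤-x x≤0) (0≤-x x≤0))
      where
      -x*-x≈x*x : - x * - x ≈ x * x
      -x*-x≈x*x = trans (sym (-‿distribˡ-* x (- x)))
        (trans (-‿cong (sym (-‿distribʳ-* x x))) (-‿involutive (x * x)))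
    0≤1 : 0# ⊑ 1#
    0≤1 = ≤-respʳ-≈ (*-identityˡ 1#) (0≤x² 1#)
    x≤x+1 : ∀ x → x ⊑ x + 1#
    x≤x+1 x = ≤-respˡ-≈ (+-identityˡ x) (≤-respʳ-≈ (+-comm 1# x) (+-mono 0# 1# x 0≤1))
    3≤0 : 1# + 1# + 1# ⊑ 0#
    3≤0 = ≤-respˡ-≈ (+-identityˡ _) (≤-respʳ-≈ (-‿inverseˡ _)
      (+-mono 0# _ (1# + 1# + 1#) (≤-respʳ-≈ y²≈-3 (0≤x² y))))
    1≤0 : 1# ⊑ 0#
    1≤0 = ⊑-trans (⊑-trans (x≤x+1 1#) (x≤x+1 (1# + 1#))) 3≤0

  Admissible⇒field×nonResidue : AdmissibleField F → IsField F × Minus3NonResidue F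
  Admissible⇒field×nonResidue (inj₁ R) =
    CompleteOrderedField.isField R , CompleteOrderedField⇒Minus3NonResidue R
  Admissible⇒field×nonResidue (inj₂ (isField , _ , nonResidue)) = isField , nonResidue

  -- In characteristic 2, -3 = 1.
  Minus3NonResidue⇒2≉0 : Minus3NonResidue F → ¬ (1# + 1# ≈ 0#)
  Minus3NonResidue⇒2≉0 nonResidue 2≈0 = nonResidue (1# , +-inverseˡ-unique _ _ (begin
    1# * 1# + (1# + 1# + 1#)
      ≈⟨ solve 1 (λ o → con 1 :* con 1 :+ (o :+ o :+ o) := con 1 :+ (o :+ o :+ o)) refl 1# ⟩
    1# + (1# + 1# + 1#)
      ≈⟨ solve 1 (λ o → o :+ (o :+ o :+ o) := (o :+ o) :+ (o :+ o)) refl 1# ⟩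
    (1# + 1#) + (1# + 1#)
      ≈⟨ +-cong 2≈0 2≈0 ⟩
    0# + 0#
      ≈⟨ +-identityˡ 0# ⟩
    0# ∎))

theorem2 : (F : CommutativeRing 0ℓ 0ℓ) → AdmissibleField F →
    (n : ℕ) → n > 5 → ¬ Polynomials.IsReadOnceDeterminant F n
theorem2 F admissible n n>5 = ≡.subst (λ n → ¬ Polynomials.IsReadOnceDeterminant F n)
  -- `n>5` unfolds to 6 ≤ n, so n is (n ∸ 6) + 6, the size of the substituted matrix.
  (ℕ.m∸n+n≡m n>5) λ (k , M , readOnce , det-M) →
    let (1≉0 , inverse) , nonResidue = Admissible⇒field×nonResidue F admissible
        -- Since -3 is a non-residue, 2 is invertible, and `½ * ½` serves as the inverse of 4.
        ½ , 2*½≈1 = inverse _ (Minus3NonResidue⇒2≉0 F nonResidue)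
    in nonResidue (Reduction.readOnceDet⇒minus3-square F (n ℕ.∸ 6) k M readOnce det-M 1≉0 (½ * ½) (begin
      # 4 * (½ * ½)
        ≈⟨ solve 1 (λ h → con 4 :* (h :* h) := (con 2 :* h) :* (con 2 :* h)) refl ½ ⟩
      (# 2 * ½) * (# 2 * ½) ≈⟨ *-cong 2*½≈1 2*½≈1 ⟩
      1# * 1#               ≈⟨ *-identityˡ 1# ⟩
      1#                    ∎))
  where
  open CommutativeRing F
  open Obstruction F using (#)
  open import Relation.Binary.Reasoning.Setoid setoid
  open NatSolver commutativeSemiring using (solve; con; _:=_; _:+_; _:*_)
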